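{- Fix $m\ge1$ and $n\ge0$. Every labelled sequent derivable in $\mathsf{Ldm}_{n}^{m}\mathsf{L}$ is valid.
   Context: Language. $Ag=\{1,\dots,m\}$, $Var$ a countable set of propositional variables; formulas of $\mathcal{L}^m$: $\phi ::= p \mid \overline{p} \mid (\phi\wedge\phi) \mid (\phi\vee\phi) \mid \Box\phi \mid \Diamond\phi \mid [i]\phi \mid \langle i\rangle\phi$. Models. An $\mathsf{Ldm}_{n}^{m}$-frame is $(W,\{\mathcal{R}_i\}_{i\in Ag})$ with $W\neq\emptyset$ and: (C1) each $\mathcal{R}_i$ is an equivalence relation on $W$; (C2) for all $u_1,\dots,u_m\in W$, $\bigcap_{i\in Ag}\mathcal{R}_i(u_i)\neq\emptyset$, where $\mathcal{R}_i(w)=\{v:(w,v)\in\mathcal{R}_i\}$; (C3) only if $n>0$: for each $i$ and all $w_0,\dots,w_n\in W$ there are $0\le k<j\le n$ with $(w_k,w_j)\in\mathcal{R}_i$. A model adds $V:Var\to\mathcal{P}(W)$. Satisfaction: $w\Vdash p$ iff $w\in V(p)$; $w\Vdash\overline{p}$ iff $w\notin V(p)$; $\wedge,\vee$ as usual; $\Box,\Diamond$ quantify over all of $W$; $[i],\langle i\rangle$ quantify (universally, existentially) over $\mathcal{R}_i(w)$. Labelled sequents $\mathcal{R},\Gamma$: $\mathcal{R}$ a multiset of relational atoms $\mathcal{R}_ixy$, $\Gamma$ a multiset of labelled formulas $x:\phi$. Given a model $M$ with domain $W$ and an interpretation $I$ mapping labels to worlds, $\mathcal{R},\Gamma$ is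 satisfied in $M$ under $I$ iff, if $(x^I,y^I)\in\mathcal{R}_i$ holds for all relational atoms $\mathcal{R}_ixy\in\mathcal{R}$, then $M,z^I\Vdash\phi$ for some $z:\phi\in\Gamma$. A sequent is valid iff it is satisfied in every $\mathsf{Ldm}_{n}^{m}$-model under every interpretation. Rules of $\mathsf{Ldm}_{n}^{m}\mathsf{L}$ (premise(s) / conclusion): $(\mathsf{id})$: / $\mathcal{R}, w:p, w:\overline{p},\Gamma$. $(\wedge)$: $\mathcal{R}, w:\phi\wedge\psi, w:\phi,\Gamma$ and $\mathcal{R}, w:\phi\wedge\psi, w:\psi,\Gamma$ / $\mathcal{R}, w:\phi\wedge\psi,\Gamma$. $(\vee)$: $\mathcal{R}, w:\phi\vee\psi, w:\phi, w:\psi,\Gamma$ / $\mathcal{R}, w:\phi\vee\psi,\Gamma$. $(\Box)$: $\mathcal{R}, w:\Box\phi, v:\phi,\Gamma$ / $\mathcal{R}, w:\Box\phi,\Gamma$ ($v$ fresh). $(\Diamond)$: $\mathcal{R}, w:\Diamond\phi, u:\phi,\Gamma$ / $\mathcal{R}, w:\Diamond\phi,\Gamma$. $(\mathsf{IOA})$: $\mathcal{R},\mathcal{R}_1u_1v,\dots,\mathcal{R}_mu_mv,\Gamma$ / $\mathcal{R},\Gamma$ ($v$ fresh). $([i])$: $\mathcal{R},\mathcal{R}_iwv, w:[i]\phi, v:\phi,\Gamma$ / $\mathcal{R}, w:[i]\phi,\Gamma$ ($v$ fresh). $(\mathsf{Pr}_i)$: $\mathcal{R}, w:\langle i\rangle\phi,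 u:\phi,\Gamma$ / $\mathcal{R}, w:\langle i\rangle\phi,\Gamma$, applicable only if $w=u$ or there are labels $w=z_0,\dots,z_k=u$ ($k\ge1$) with $\mathcal{R}_iz_lz_{l+1}\in\mathcal{R}$ or $\mathcal{R}_iz_{l+1}z_l\in\mathcal{R}$ for each $l<k$. $(\mathsf{APC}^i_n)$ (only if $n>0$): premises $\mathcal{R},\mathcal{R}_iw_kw_j,\Gamma$ for all $0\le k\le n-1$, $k+1\le j\le n$ / $\mathcal{R},\Gamma$. "Fresh" means not occurring in the conclusion. One copy of $([i])$, $(\mathsf{Pr}_i)$, $(\mathsf{APC}^i_n)$ for each $i\in Ag$. -}

module Defs where

open import Data.Fin.Base using (Fin) renaming (_<_ to _<ᶠ_)
open import Data.List.Base using (List; _∷_; _++_; tabulate)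
open import Data.List.Membership.Propositional using (_∈_)
open import Data.List.Relation.Binary.Permutation.Propositional using (_↭_)
open import Data.List.Relation.Unary.All using (All)
open import Data.List.Relation.Unary.Any using (Any)
open import Data.Nat.Base using (ℕ; suc; _>_)
open import Data.Product.Base using (∃-syntax; _×_)
open import Data.Sum.Base using (_⊎_)
open import Level using (Level) renaming (suc to lsuc)
open import Relation.Binary.Construct.Closure.Equivalence using (EqClosure)
open import Relation.Binary.Core using (Rel)
open import Relation.Binary.PropositionalEquality.Core using (_≢_)
open import Relation.Binary.Structures using (IsEquivalence)
open import Relation.Nullary.Negation.Core using (¬_)
open import Relation.Unary using (Pred)

private
  variable
    m n : ℕ

Var : Set
Var = ℕ

Label : Set
Label = ℕ

-- The agents 1, …, m are the elements of Fin m.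
data Formula (m : ℕ) : Set where
  var      : Var → Formula m
  nvar     : Var → Formula m
  _∧_ _∨_  : Formula m → Formula m → Formula m
  □ ◇      : Formula m → Formula m
  [_]_ ⟨_⟩_ : Fin m → Formula m → Formula m

infixr 7 _∧_
infixr 6 _∨_
infixr 8 [_]_ ⟨_⟩_

record Frame (ℓ : Level) (m n : ℕ) : Set (lsuc ℓ) where
  field
    W         : Set ℓ
    inhabited : W
    R         : Fin m → Rel W ℓ
    C1        : ∀ i → IsEquivalence (R i)
    C2        : (u : Fin m → W) → ∃[ v ] (∀ i → R i (u i) v)
    C3        : n > 0 → ∀ i (w : Fin (suc n) → W) →
                ∃[ k ] ∃[ j ] (k <ᶠ j × R i (w k) (w j))

record Model (ℓ : Level) (m n : ℕ) : Set (lsuc ℓ) where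
  field
    frame : Frame ℓ m n
  open Frame frame public
  field
    V : Var → Pred W ℓ

record RelAtom (m : ℕ) : Set where
  constructor 𝓡
  field
    agent         : Fin m
    source target : Label

infix 5 _∶_
record LabelledFormula (m : ℕ) : Set where
  constructor _∶_
  field
    label   : Label
    formula : Formula m

-- Both components are read as multisets: derivability is closed under
-- permuting them (constructor exch of Derivable).
infix 3 _⨾_
record Sequent (m : ℕ) : Set where
  constructor _⨾_
  field
    atoms    : List (RelAtom m)
    formulas : List (LabelledFormula m)

module Satisfaction {ℓ : Level} {m n : ℕ} (M : Model ℓ m n) where
  open Model M

  infix 4 _⊩_
  _⊩_ : W → Formula m → Set ℓ
  w ⊩ var p     = V p w
  w ⊩ nvar p    = ¬ V p w
  w ⊩ φ ∧ ψ     = (w ⊩ φ) × (w ⊩ ψ)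
  w ⊩ φ ∨ ψ     = (w ⊩ φ) ⊎ (w ⊩ ψ)
  w ⊩ □ φ       = ∀ u → u ⊩ φ
  w ⊩ ◇ φ       = ∃[ u ] (u ⊩ φ)
  w ⊩ [ i ] φ   = ∀ u → R i w u → u ⊩ φ
  w ⊩ ⟨ i ⟩ φ   = ∃[ u ] (R i w u × u ⊩ φ)

  Satisfied : (Label → W) → Sequent m → Set ℓ
  Satisfied I (𝓢 ⨾ Γ) =
    All (λ (𝓡 i x y) → R i (I x) (I y)) 𝓢 → Any (λ (z ∶ φ) → I z ⊩ φ) Γ

Valid : (ℓ : Level) (n : ℕ) → Sequent m → Set (lsuc ℓ)
Valid {m} ℓ n S =
  (M : Model ℓ m n) (I : Label → Model.W M) → Satisfaction.Satisfied M I S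

Fresh : Label → Sequent m → Set
Fresh v (𝓢 ⨾ Γ) =
  All (λ (𝓡 _ x y) → v ≢ x × v ≢ y) 𝓢 × All (λ (z ∶ _) → v ≢ z) Γ

-- The equivalence closure consists of the finite, possibly empty, paths whose
-- steps are atoms 𝓡 i x y of 𝓢 traversed in either direction.
Connected : List (RelAtom m) → Fin m → Label → Label → Set
Connected 𝓢 i = EqClosure (λ x y → 𝓡 i x y ∈ 𝓢)

data Derivable (n : ℕ) {m : ℕ} : Sequent m → Set where

  exch : ∀ {𝓢 𝓢′ Γ Γ′} → 𝓢 ↭ 𝓢′ → Γ ↭ Γ′ →
         Derivable n (𝓢 ⨾ Γ) →
         Derivable n (𝓢′ ⨾ Γ′)

  id : ∀ {𝓢 Γ w p} →
       Derivable n (𝓢 ⨾ (w ∶ var p) ∷ (w ∶ nvar p) ∷ Γ)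

  ∧-rule : ∀ {𝓢 Γ w φ ψ} →
           Derivable n (𝓢 ⨾ (w ∶ φ ∧ ψ) ∷ (w ∶ φ) ∷ Γ) →
           Derivable n (𝓢 ⨾ (w ∶ φ ∧ ψ) ∷ (w ∶ ψ) ∷ Γ) →
           Derivable n (𝓢 ⨾ (w ∶ φ ∧ ψ) ∷ Γ)

  ∨-rule : ∀ {𝓢 Γ w φ ψ} →
           Derivable n (𝓢 ⨾ (w ∶ φ ∨ ψ) ∷ (w ∶ φ) ∷ (w ∶ ψ) ∷ Γ) →
           Derivable n (𝓢 ⨾ (w ∶ φ ∨ ψ) ∷ Γ)

  □-rule : ∀ {𝓢 Γ w v φ} →
           Fresh v (𝓢 ⨾ (w ∶ □ φ) ∷ Γ) →
           Derivable n (𝓢 ⨾ (w ∶ □ φ) ∷ (v ∶ φ) ∷ Γ) →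
           Derivable n (𝓢 ⨾ (w ∶ □ φ) ∷ Γ)

  ◇-rule : ∀ {𝓢 Γ w u φ} →
           Derivable n (𝓢 ⨾ (w ∶ ◇ φ) ∷ (u ∶ φ) ∷ Γ) →
           Derivable n (𝓢 ⨾ (w ∶ ◇ φ) ∷ Γ)

  IOA : ∀ {𝓢 Γ v} (u : Fin m → Label) →
        Fresh v (𝓢 ⨾ Γ) →
        Derivable n (tabulate (λ i → 𝓡 i (u i) v) ++ 𝓢 ⨾ Γ) →
        Derivable n (𝓢 ⨾ Γ)

  []-rule : ∀ {𝓢 Γ w v φ} (i : Fin m) →
            Fresh v (𝓢 ⨾ (w ∶ [ i ] φ) ∷ Γ) →
            Derivable n (𝓡 i w v ∷ 𝓢 ⨾ (w ∶ [ i ] φ) ∷ (v ∶ φ) ∷ Γ) →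
            Derivable n (𝓢 ⨾ (w ∶ [ i ] φ) ∷ Γ)

  Pr : ∀ {𝓢 Γ w u φ} (i : Fin m) →
       Connected 𝓢 i w u →
       Derivable n (𝓢 ⨾ (w ∶ ⟨ i ⟩ φ) ∷ (u ∶ φ) ∷ Γ) →
       Derivable n (𝓢 ⨾ (w ∶ ⟨ i ⟩ φ) ∷ Γ)

  APC : ∀ {𝓢 Γ} → n > 0 → (i : Fin m) (w : Fin (suc n) → Label) →
        (∀ k j → k <ᶠ j → Derivable n (𝓡 i (w k) (w j) ∷ 𝓢 ⨾ Γ)) →
        Derivable n (𝓢 ⨾ Γ)

{-# OPTIONS --safe #-}
module Submission where

open import Defs
open import Data.Nat.Base using (ℕ; _≥_)
open import Axiom.ExcludedMiddle using (ExcludedMiddle)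
open import Data.List.Base using (_∷_)
open import Data.List.Relation.Binary.Permutation.Propositional using (↭-sym)
open import Data.List.Relation.Binary.Permutation.Propositional.Properties
  using (All-resp-↭; Any-resp-↭)
open import Data.List.Relation.Unary.All as All using (All; _∷_)
open import Data.List.Relation.Unary.All.Properties using (++⁺; tabulate⁺)
open import Data.List.Relation.Unary.Any using (Any; here; there)
open import Data.Nat.Properties using (_≟_)
open import Data.Product.Base using (_×_; _,_)
open import Data.Sum.Base using (_⊎_; inj₁; inj₂; [_,_]′)
open import Function.Base using (_∘_) renaming (id to identity)
open import Level using (Level)
open import Relation.Binary.Construct.Closure.Equivalence using (gfold)
open import Relation.Binary.Structures using (IsEquivalence)
open import Relation.Binary.PropositionalEquality
  using (_≡_; _≢_; refl; sym; subst; subst₂)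
open import Relation.Nullary.Decidable.Core using (yes; no)
open import Relation.Nullary.Negation.Core using (¬_; contradiction)

private
  variable
    ℓ : Level
    m n : ℕ

module _ {W : Set ℓ} where

  infixl 9 _[_≔_]
  _[_≔_] : (Label → W) → Label → W → Label → W
  (I [ v ≔ u ]) x with v ≟ x
  ... | yes _ = u
  ... | no  _ = I x

  update-same : (I : Label → W) (v : Label) (u : W) → (I [ v ≔ u ]) v ≡ u
  update-same I v u with v ≟ v
  ... | yes _  = refl
  ... | no v≢v = contradiction refl v≢v

  update-other : (I : Label → W) {v x : Label} (u : W) → v ≢ x →
                 (I [ v ≔ u ]) x ≡ I x
  update-other I {v} {x} u v≢x with v ≟ x
  ... | yes v≡x = contradiction v≡x v≢x
  ... | no  _   = refl

module Soundness (em : ExcludedMiddle ℓ) (M : Model ℓ m n) where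
  open Model M
  open Satisfaction M

  Holds : (Label → W) → RelAtom m → Set ℓ
  Holds I (𝓡 i x y) = R i (I x) (I y)

  True : (Label → W) → LabelledFormula m → Set ℓ
  True I (z ∶ φ) = I z ⊩ φ

  -- The pullback of `R i` along `I` is an equivalence containing the atoms for `i`, so it contains
  -- the equivalence closure they generate.
  connected⇒R : ∀ {I 𝓢 i x y} → All (Holds I) 𝓢 → Connected 𝓢 i x y →
                R i (I x) (I y)
  connected⇒R {I} {i = i} hs = gfold (C1 i) I (All.lookup hs)

  -- Atoms are the antecedent of a sequent, so they are carried from `I` to the updated
  -- interpretation; `true-restore` carries formulas, the consequent, back.
  holds-update : ∀ {I 𝓢 v} u → All (λ (𝓡 _ x y) → v ≢ x × v ≢ y) 𝓢 →
                 All (Holds I) 𝓢 → All (Holds (I [ v ≔ u ])) 𝓢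
  holds-update {I} u fresh hs = All.zipWith
    (λ { {𝓡 i _ _} ((v≢x , v≢y) , h) →
         subst₂ (R i) (sym (update-other I u v≢x)) (sym (update-other I u v≢y)) h })
    (fresh , hs)

  true-restore : ∀ {I Γ v} u → All (λ (z ∶ _) → v ≢ z) Γ →
                 Any (True (I [ v ≔ u ])) Γ → Any (True I) Γ
  true-restore {I} u (v≢z ∷ _) (here {x = _ ∶ φ} t) =
    here (subst (_⊩ φ) (update-other I u v≢z) t)
  true-restore u (_ ∷ fresh) (there t) = there (true-restore u fresh t)

  -- No freshness is assumed, since IOA allows v itself among the labels uᵢ;
  -- reflexivity settles that case.
  R-update : ∀ I v x {i u} → R i (I x) u → R i ((I [ v ≔ u ]) x) ((I [ v ≔ u ]) v)
  R-update I v x {i} {u} r rewrite update-same I v u with v ≟ x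
  ... | yes _ = IsEquivalence.refl (C1 i)
  ... | no  _ = r

  -- Reads off the premise of a universal rule once the context is false: `ψ` stands for the
  -- principal formula `□ φ` or `[ i ] φ`.
  true-fresh : ∀ {I Γ v w φ ψ} u → v ≢ w → All (λ (z ∶ _) → v ≢ z) Γ →
               ¬ Any (True I) Γ →
               Any (True (I [ v ≔ u ])) ((w ∶ ψ) ∷ (v ∶ φ) ∷ Γ) →
               (I w ⊩ ψ) ⊎ (u ⊩ φ)
  true-fresh {I} {ψ = ψ} u v≢w _ _ (here t) =
    inj₁ (subst (_⊩ ψ) (update-other I u v≢w) t)
  true-fresh {I} {v = v} {φ = φ} u _ _ _ (there (here t)) =
    inj₂ (subst (_⊩ φ) (update-same I v u) t)
  true-fresh u _ fresh ¬Γ (there (there t)) =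
    contradiction (true-restore u fresh t) ¬Γ

  -- Excluded middle yields the standard reading of a sequent with a universal
  -- principal formula: it may be assumed that the context Γ is false.
  head-or-tail : ∀ {I A Γ} → (¬ Any (True I) Γ → True I A) → Any (True I) (A ∷ Γ)
  head-or-tail {I} {Γ = Γ} f with em {Any (True I) Γ}
  ... | yes t = there t
  ... | no ¬t = here (f ¬t)

  -- The interpretation is quantified after the derivation, so that the induction hypothesis applies
  -- to updated interpretations.
  satisfied : ∀ {S} → Derivable n S → ∀ I → Satisfied I S
  satisfied (exch p q d) I hs =
    Any-resp-↭ q (satisfied d I (All-resp-↭ (↭-sym p) hs))
  satisfied (id {w = w} {p = p}) I hs with em {V p (I w)}
  ... | yes t = here t
  ... | no ¬t = there (here ¬t)
  satisfied (∧-rule d e) I hs with satisfied d I hs | satisfied e I hs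
  ... | here t          | _               = here t
  ... | there (there t) | _               = there t
  ... | there (here _)  | here t          = here t
  ... | there (here _)  | there (there t) = there t
  ... | there (here s)  | there (here t)  = here (s , t)
  satisfied (∨-rule d) I hs with satisfied d I hs
  ... | here t                  = here t
  ... | there (here t)          = here (inj₁ t)
  ... | there (there (here t))  = here (inj₂ t)
  ... | there (there (there t)) = there t
  -- Both outcomes of `true-fresh` give `φ` at `u`: a true principal formula is simply instantiated
  -- there.
  satisfied (□-rule (fresh𝓢 , v≢w ∷ freshΓ) d) I hs = head-or-tail λ ¬Γ u →
    [ (λ t → t u) , identity ]′
      (true-fresh u v≢w freshΓ ¬Γ (satisfied d _ (holds-update u fresh𝓢 hs)))
  satisfied (◇-rule {u = u} d) I hs with satisfied d I hs
  ... | here t          = here t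
  ... | there (here t)  = here (I u , t)
  ... | there (there t) = there t
  -- The world that `C2` provides for the values of the labels `u i` becomes the value of `v`,
  -- making all the new atoms true at once.
  satisfied (IOA {v = v} u (fresh𝓢 , freshΓ) d) I hs with C2 (I ∘ u)
  ... | x , r = true-restore x freshΓ (satisfied d _
    (++⁺ (tabulate⁺ λ i → R-update I v (u i) (r i)) (holds-update x fresh𝓢 hs)))
  satisfied ([]-rule {w = w} {v = v} i (fresh𝓢 , v≢w ∷ freshΓ) d) I hs = head-or-tail λ ¬Γ u r →
    [ (λ t → t u r) , identity ]′
      (true-fresh u v≢w freshΓ ¬Γ
        (satisfied d _ (R-update I v w r ∷ holds-update u fresh𝓢 hs)))
  satisfied (Pr {u = u} i c d) I hs with satisfied d I hs
  ... | here t          = here t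
  ... | there (here t)  = here (I u , connected⇒R hs c , t)
  ... | there (there t) = there t
  -- `C3` selects which premise to use: the one whose added atom is true under `I`.
  satisfied (APC n>0 i w d) I hs with C3 n>0 i (I ∘ w)
  ... | k , j , k<j , r = satisfied (d k j k<j) I (r ∷ hs)

theorem4 : ∀ {ℓ} → ExcludedMiddle ℓ →
    (m n : ℕ) → m ≥ 1 →
    (S : Sequent m) → Derivable n S → Valid ℓ n S
theorem4 em m n m≥1 S d M = Soundness.satisfied em M d
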